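{- For every integer $n\ge 1$, $$ \nu_3(T(n))=\begin{cases} 0, & n\equiv 1,2,3,4,5,6,8,10,11\pmod{13};\\ 1, & n\equiv 7\pmod{13};\\ \nu_3(n)+2, & n\equiv 0\pmod{13};\\ \nu_3(n+1)+2, & n\equiv 12\pmod{13};\\ 4, & n\equiv 9\pmod{39};\\ \nu_3(n+17)+4, & n\equiv 22\pmod{39};\\ \nu_3(n+4)+4, & n\equiv 35\pmod{39}. \end{cases} $$
   Context: $T:\mathbb Z\to\mathbb Z$ is the Tribonacci sequence defined by $T(0)=0$, $T(1)=T(2)=1$ and $T(n+3)=T(n+2)+T(n+1)+T(n)$ for all $n\in\mathbb Z$. For a prime $p$, $\nu_p$ denotes the $p$-adic valuation (exponent of $p$), with $\nu_p(0)=+\infty$. -}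

module Defs where

open import Data.Integer.Base as ℤ
  using (ℤ; +_; +[1+_]; -[1+_]; _+_; _-_; ∣_∣; 0ℤ; 1ℤ; -1ℤ)
open import Data.Integer.Divisibility using (_∣_)
open import Data.Integer.Tactic.RingSolver using (solve-∀)
open import Data.Nat.Base as ℕ using (ℕ; zero; suc; _^_; NonTrivial; NonZero)
import Data.Nat.Divisibility as ℕ
import Data.Nat.Properties as ℕ
open import Data.Product.Base using (_×_; _,_)
open import Data.Sum.Base using (inj₁; inj₂)
open import Function.Bundles using (_⇔_; mk⇔)
open import Function.Construct.Composition using (_⇔-∘_)
open import Relation.Binary.PropositionalEquality using (_≡_; refl; sym; cong)
open import Relation.Nullary.Construct.Add.Supremum using (_⁺; [_]; ⊤⁺)
open import Relation.Nullary.Decidable.Core using (yes; no)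
open import Relation.Nullary.Negation.Core using (¬_; contradiction)

-- At negative arguments the recurrence is solved for its lowest term:
-- T(m) = T(m+3) - T(m+2) - T(m+1).  `T-rec` below confirms that it then
-- holds at every integer.
T : ℤ → ℤ
T (+ 0)                         = 0ℤ
T (+ 1)                         = 1ℤ
T (+ 2)                         = 1ℤ
T (+ suc (suc (suc n)))         = T (+ suc (suc n)) + T (+ suc n) + T (+ n)
T -[1+ 0 ]                      = 0ℤ
T -[1+ 1 ]                      = 1ℤ
T -[1+ 2 ]                      = -1ℤ
T -[1+ suc (suc (suc n)) ]      =
  T -[1+ n ] - T -[1+ suc n ] - T -[1+ suc (suc n) ]

T-rec : ∀ n → T (n + + 3) ≡ T (n + + 2) + T (n + + 1) + T n
T-rec (+ n) rewrite ℕ.+-comm n 3 | ℕ.+-comm n 2 | ℕ.+-comm n 1 = refl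
T-rec -[1+ 0 ] = refl
T-rec -[1+ 1 ] = refl
T-rec -[1+ 2 ] = refl
T-rec -[1+ suc (suc (suc n)) ] =
  solve (T -[1+ n ]) (T -[1+ suc n ]) (T -[1+ suc (suc n) ])
  where
  solve : ∀ a b c → a ≡ b + c + (a - b - c)
  solve = solve-∀

ℕ∞ : Set
ℕ∞ = ℕ ⁺

infixl 6 _∔_

_∔_ : ℕ∞ → ℕ → ℕ∞
[ k ] ∔ l = [ k ℕ.+ l ]
⊤⁺    ∔ l = ⊤⁺

-- The greatest k ≤ b such that p ^ k divides m.
maxExp : (p m b : ℕ) → ℕ
maxExp p m zero    = 0
maxExp p m (suc b) with (p ^ suc b) ℕ.∣? m
... | yes _ = suc b
... | no  _ = maxExp p m b

-- The search bound ∣ m ∣ is large enough: if p ≥ 2, m ≠ 0 and p ^ k divides m,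
-- then k < p ^ k ≤ ∣ m ∣.  See `ν-spec`.
ν : (p : ℕ) .{{_ : NonTrivial p}} → ℤ → ℕ∞
ν p (+ 0) = ⊤⁺
ν p m     = [ maxExp p ∣ m ∣ ∣ m ∣ ]

maxExp-∣ : ∀ p m b → (p ^ maxExp p m b) ℕ.∣ m
maxExp-∣ p m zero    = ℕ.1∣ m
maxExp-∣ p m (suc b) with (p ^ suc b) ℕ.∣? m
... | yes d = d
... | no  _ = maxExp-∣ p m b

maxExp-max : ∀ p m b k → k ℕ.≤ b → (p ^ k) ℕ.∣ m → k ℕ.≤ maxExp p m b
maxExp-max p m zero    k k≤b d = k≤b
maxExp-max p m (suc b) k k≤b d with (p ^ suc b) ℕ.∣? m
... | yes _ = k≤b
... | no ¬d = maxExp-max p m b k (ℕ.≤-pred (ℕ.≤∧≢⇒< k≤b λ { refl → ¬d d })) d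

k<p^k : ∀ p .{{_ : NonTrivial p}} k → k ℕ.< p ^ k
k<p^k p zero    = ℕ.z<s
k<p^k p (suc k) = ℕ.≤-<-trans (k<p^k p k)
  (ℕ.^-monoʳ-< p (ℕ.nonTrivial⇒n>1 p) (ℕ.n<1+n k))

^-monoʳ-∣ : ∀ p {k l} → k ℕ.≤ l → (p ^ k) ℕ.∣ (p ^ l)
^-monoʳ-∣ p ℕ.z≤n       = ℕ.1∣ _
^-monoʳ-∣ p (ℕ.s≤s k≤l) = ℕ.*-monoʳ-∣ p (^-monoʳ-∣ p k≤l)

[]-⇔ : {i j : ℕ} → _≡_ {A = ℕ∞} [ i ] [ j ] ⇔ i ≡ j
[]-⇔ = mk⇔ (λ { refl → refl }) (cong [_])

maxExp-exact : ∀ p .{{_ : NonTrivial p}} m .{{_ : NonZero m}} k →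
               maxExp p m m ≡ k ⇔ ((p ^ k) ℕ.∣ m × ¬ (p ^ suc k) ℕ.∣ m)
maxExp-exact p m k = mk⇔ to from
  where
  max : ∀ l → (p ^ l) ℕ.∣ m → l ℕ.≤ maxExp p m m
  max l d = maxExp-max p m m l
    (ℕ.≤-trans (ℕ.<⇒≤ (k<p^k p l)) (ℕ.∣⇒≤ d)) d

  to : maxExp p m m ≡ k → (p ^ k) ℕ.∣ m × ¬ (p ^ suc k) ℕ.∣ m
  to refl = maxExp-∣ p m m , λ d → ℕ.<-irrefl refl (max _ d)

  from : (p ^ k) ℕ.∣ m × ¬ (p ^ suc k) ℕ.∣ m → maxExp p m m ≡ k
  from (d , ¬d) with ℕ.m≤n⇒m<n∨m≡n (max k d)
  ... | inj₂ k≡e = sym k≡e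
  ... | inj₁ k<e = contradiction
    (ℕ.∣-trans (^-monoʳ-∣ p k<e) (maxExp-∣ p m m)) ¬d

ν-spec : ∀ p .{{_ : NonTrivial p}} m .{{_ : ℤ.NonZero m}} k →
         ν p m ≡ [ k ] ⇔ ((+ (p ^ k) ∣ m) × ¬ (+ (p ^ suc k) ∣ m))
ν-spec p +[1+ n ] k = maxExp-exact p (suc n) k ⇔-∘ []-⇔
ν-spec p -[1+ n ] k = maxExp-exact p (suc n) k ⇔-∘ []-⇔

infix 4 _≡_[mod_]

_≡_[mod_] : ℤ → ℤ → ℕ → Set
a ≡ b [mod m ] = + m ∣ a - b

{-# OPTIONS --safe #-}
module Submission where

-- Along the progression z + m p, with p = 13 or 39, T has the Newton expansion
-- Σₖ C(m,k) dₖ.  For a root x of x³ = x² + x + 1, x^p - 1 is divisible by 3, so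
-- that 3 ^ (k + t) divides dₖ for all k as soon as it does for k ≤ 2.  Since
-- k C(m,k) = m C(m-1,k-1) and k divides 3 ^ (k-2) 3-adically for k ≥ 2, this gives
-- T(z + m p) ≡ d₀ + m d₁ modulo 3 ^ (t+2+a) whenever 3 ^ a divides m.  The theorem
-- is read off at the zeros z = 0, -1, -4, -17 of T, where d₀ = 0 and
-- ν₃(d₁) = t + 1, and elsewhere from ν₃(d₀) = t.

open import Defs
open import Data.Integer.Base as ℤ
  using (ℤ; +_; +[1+_]; -[1+_]; _+_; _-_; _*_; -_; _^_; _≤_; +≤+; 0ℤ; 1ℤ)
open import Data.Integer.Divisibility.Signed
  using (_∣_; divides; _∣?_; ∣-trans; ∣m∣n⇒∣m+n; ∣m∣n⇒∣m-n; ∣m+n∣n⇒∣m; ∣n⇒∣m*n; ∣m⇒∣m*n;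
         *-monoʳ-∣; *-monoˡ-∣; *-cancelʳ-∣; ∣ᵤ⇒∣; ∣⇒∣ᵤ)
import Data.Integer.Properties as ℤ
open import Data.Integer.Tactic.RingSolver using (solve-∀)
open import Data.List.Base using ([]; _∷_)
open import Data.List.Relation.Unary.All as All using (All; []; _∷_)
open import Data.List.Relation.Unary.Any using (Any)
open import Data.Nat.Base as ℕ using (ℕ; zero; suc; s≤s; nonTrivial)
import Data.Nat.Divisibility as ℕ
import Data.Nat.DivMod as ℕ
open import Data.Nat.Primality using (prime?; euclidsLemma)
import Data.Nat.Properties as ℕ
open import Data.Product.Base using (_×_; _,_; proj₁; proj₂; ∃-syntax)
open import Data.Sum.Base using ([_,_]′)
open import Function.Base using (_∘_)
open import Function.Bundles using (Equivalence)
open import Function.Strict using (force; force-≡)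
open import Relation.Binary.PropositionalEquality
  using (_≡_; refl; sym; trans; cong; cong₂; subst; module ≡-Reasoning)
open import Relation.Nullary.Construct.Add.Supremum using ([_]; ⊤⁺)
open import Relation.Nullary.Decidable
  using (Dec; True; False; yes; no; from-yes; toWitness; toWitnessFalse; _×-dec_)
open import Relation.Nullary.Negation.Core using (¬_; contradiction)

-- Newton expansions.

-- Σₖ C(m,k) d k, with Pascal's rule in place of explicit binomial coefficients.
newton : (ℕ → ℤ) → ℕ → ℤ
newton d zero    = d 0
newton d (suc m) = newton d m + newton (d ∘ suc) m

newton-cong : ∀ {c d} → (∀ k → c k ≡ d k) → ∀ m → newton c m ≡ newton d m
newton-cong c≗d zero    = c≗d 0
newton-cong c≗d (suc m) = cong₂ _+_ (newton-cong c≗d m) (newton-cong (c≗d ∘ suc) m)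

newton-+ : ∀ c d m → newton (λ k → c k + d k) m ≡ newton c m + newton d m
newton-+ c d zero    = refl
newton-+ c d (suc m) = trans
  (cong₂ _+_ (newton-+ c d m) (newton-+ (c ∘ suc) (d ∘ suc) m))
  (interchange (newton c m) (newton d m) _ _)
  where
  interchange : ∀ w x y z → w + x + (y + z) ≡ w + y + (x + z)
  interchange = solve-∀

newton-∣ : ∀ {i d} → (∀ k → i ∣ d k) → ∀ m → i ∣ newton d m
newton-∣ i∣d zero    = i∣d 0
newton-∣ i∣d (suc m) = ∣m∣n⇒∣m+n (newton-∣ i∣d m) (newton-∣ (i∣d ∘ suc) m)

newton-≡-head : ∀ {i} d → (∀ k → i ∣ d (suc k)) → ∀ m → i ∣ newton d m - d 0
newton-≡-head d i∣d zero    = divides 0ℤ (ℤ.+-inverseʳ (d 0))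
newton-≡-head d i∣d (suc m) = subst (_ ∣_)
  (rearrange (newton d m) (d 0) (newton (d ∘ suc) m))
  (∣m∣n⇒∣m+n (newton-≡-head d i∣d m) (newton-∣ i∣d m))
  where
  rearrange : ∀ x y z → x - y + z ≡ x + z - y
  rearrange = solve-∀

-- The absorption identity k C(m+1,k) = (m+1) C(m,k-1), summed against c.
newton-absorption : ∀ c m →
  newton (λ k → + k * c k) (suc m) ≡ + suc m * newton (c ∘ suc) m
newton-absorption c zero    = base (c 0) (c 1)
  where
  base : ∀ x y → 0ℤ * x + 1ℤ * y ≡ 1ℤ * y
  base = solve-∀
newton-absorption c (suc m) = begin
  newton (λ k → + k * c k) (suc m) + newton (λ k → + suc k * c (suc k)) (suc m)
    ≡⟨ cong₂ _+_ (newton-absorption c m)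
         (trans (newton-cong (λ k → distrib (+ k) (c (suc k))) (suc m))
           (newton-+ (c ∘ suc) (λ k → + k * c (suc k)) (suc m))) ⟩
  + suc m * newton (c ∘ suc) m
    + (newton (c ∘ suc) (suc m) + newton (λ k → + k * c (suc k)) (suc m))
    ≡⟨ cong (λ x → + suc m * newton (c ∘ suc) m + (newton (c ∘ suc) (suc m) + x))
         (newton-absorption (c ∘ suc) m) ⟩
  + suc m * newton (c ∘ suc) m
    + (newton (c ∘ suc) (suc m) + + suc m * newton (c ∘ suc ∘ suc) m)
    ≡⟨ collect (+ suc m) (newton (c ∘ suc) m) (newton (c ∘ suc ∘ suc) m) ⟩
  + suc (suc m) * newton (c ∘ suc) (suc m) ∎
  where
  open ≡-Reasoning
  distrib : ∀ x y → (1ℤ + x) * y ≡ y + x * y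
  distrib = solve-∀
  collect : ∀ n x y → n * x + (x + y + n * y) ≡ (1ℤ + n) * (x + y)
  collect = solve-∀

-- Finite differences of recurrent sequences.

Δ : (ℕ → ℤ) → ℕ → ℤ
Δ f m = f (suc m) - f m

differences : (ℕ → ℤ) → ℕ → ℤ
differences f zero    = f 0
differences f (suc k) = differences (Δ f) k

-- Dropping the first difference of f leaves the differences of Δ f, so induction on m for all f at
-- once reduces this to f m + Δ f m = f (m + 1).
newton-differences : ∀ f m → newton (differences f) m ≡ f m
newton-differences f zero    = refl
newton-differences f (suc m) = trans
  (cong₂ _+_ (newton-differences f m) (newton-differences (Δ f) m))
  (telescope (f m) (f (suc m)))
  where
  telescope : ∀ x y → x + (y - x) ≡ y
  telescope = solve-∀

Recurrence : ℤ → ℤ → (ℕ → ℤ) → Set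
Recurrence A B f = ∀ m → f (3 ℕ.+ m) ≡ A * f (2 ℕ.+ m) + B * f (1 ℕ.+ m) + f m

-- X³ = A X² + B X + 1 rewritten in powers of X - 1.
differences-recurrence : ∀ {A B} f → Recurrence A B f → ∀ k →
  differences f (3 ℕ.+ k) ≡
    (A - + 3) * differences f (2 ℕ.+ k)
    + (+ 2 * A + B - + 3) * differences f (1 ℕ.+ k) + (A + B) * differences f k
differences-recurrence {A} {B} f rec zero
  rewrite rec 0 = expand A B (f 0) (f 1) (f 2)
  where
  expand : ∀ A B x y z →
    ((A * z + B * y + x - z) - (z - y)) - ((z - y) - (y - x)) ≡
    (A - + 3) * ((z - y) - (y - x)) + (+ 2 * A + B - + 3) * (y - x) + (A + B) * x
  expand = solve-∀
differences-recurrence {A} {B} f rec (suc k) =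
  differences-recurrence {A} {B} (Δ f) Δ-rec k
  where
  expand : ∀ A B x y z →
    (A * (A * z + B * y + x) + B * z + y) - (A * z + B * y + x) ≡
    A * ((A * z + B * y + x) - z) + B * (z - y) + (y - x)
  expand = solve-∀
  Δ-rec : Recurrence A B (Δ f)
  Δ-rec m rewrite rec (suc m) | rec m = expand A B (f m) (f (1 ℕ.+ m)) (f (2 ℕ.+ m))

-- In `differences-recurrence` the terms of index k + 2, k + 1 and k fall short of 3 ^ (3 + k + t)
-- by 3, 9 and 27, which their coefficients supply.
∣-differences : ∀ {A B} f t → Recurrence A B f →
  + 3 ∣ A - + 3 → + 9 ∣ + 2 * A + B - + 3 → + 27 ∣ A + B →
  (+ 3) ^ t ∣ differences f 0 → (+ 3) ^ (1 ℕ.+ t) ∣ differences f 1 →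
  (+ 3) ^ (2 ℕ.+ t) ∣ differences f 2 →
  ∀ k → (+ 3) ^ (k ℕ.+ t) ∣ differences f k
∣-differences {A} {B} f t rec ∣α ∣β ∣γ ∣d₀ ∣d₁ ∣d₂ = go
  where
  ∣-* : ∀ {i j x y} → i ∣ x → j ∣ y → i * j ∣ x * y
  ∣-* {j = j} {x} i∣x j∣y = ∣-trans (*-monoˡ-∣ j i∣x) (*-monoʳ-∣ x j∣y)
  nine : ∀ p → + 9 * (+ 3 * p) ≡ + 3 * (+ 3 * (+ 3 * p))
  nine = solve-∀
  twenty-seven : ∀ p → + 27 * p ≡ + 3 * (+ 3 * (+ 3 * p))
  twenty-seven = solve-∀
  go : ∀ k → (+ 3) ^ (k ℕ.+ t) ∣ differences f k
  go 0 = ∣d₀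
  go 1 = ∣d₁
  go 2 = ∣d₂
  go (suc (suc (suc k))) = subst (_ ∣_) (sym (differences-recurrence {A} {B} f rec k))
    (∣m∣n⇒∣m+n
      (∣m∣n⇒∣m+n
        (∣-* ∣α (go (suc (suc k))))
        (subst (_∣ _) (nine ((+ 3) ^ (k ℕ.+ t))) (∣-* ∣β (go (suc k)))))
      (subst (_∣ _) (twenty-seven ((+ 3) ^ (k ℕ.+ t))) (∣-* ∣γ (go k))))

-- Division modulo powers of 3.

inverse-mod-3 : ∀ k → ¬ 3 ℕ.∣ k → ∃[ q ] + 3 ∣ 1ℤ - + k * q
inverse-mod-3 k 3∤k with k ℕ.% 3 | ℕ.m≡m%n+[m/n]*n k 3 | ℕ.m%n<n k 3
... | 0 | eq | _ = contradiction (ℕ.divides (k ℕ./ 3) eq) 3∤k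
... | 1 | eq | _ = 1ℤ , divides (- + (k ℕ./ 3))
  (trans (cong (λ x → 1ℤ - x * 1ℤ) (trans (cong +_ eq) (cong (λ x → 1ℤ + x) (ℤ.pos-* (k ℕ./ 3) 3))))
    (ring (+ (k ℕ./ 3))))
  where
  ring : ∀ x → 1ℤ - (1ℤ + x * + 3) * 1ℤ ≡ - x * + 3
  ring = solve-∀
... | 2 | eq | _ = - 1ℤ , divides (1ℤ + + (k ℕ./ 3))
  (trans (cong (λ x → 1ℤ - x * - 1ℤ) (trans (cong +_ eq) (cong (λ x → + 2 + x) (ℤ.pos-* (k ℕ./ 3) 3))))
    (ring (+ (k ℕ./ 3))))
  where
  ring : ∀ x → 1ℤ - (+ 2 + x * + 3) * - 1ℤ ≡ (1ℤ + x) * + 3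
  ring = solve-∀
... | suc (suc (suc _)) | _ | s≤s (s≤s (s≤s ()))

inverse-mod-3^ : ∀ a k → ¬ 3 ℕ.∣ k → ∃[ q ] (+ 3) ^ a ∣ 1ℤ - + k * q
inverse-mod-3^ zero    k 3∤k = 0ℤ , divides (1ℤ - + k * 0ℤ) (sym (ℤ.*-identityʳ _))
inverse-mod-3^ (suc a) k 3∤k with inverse-mod-3 k 3∤k | inverse-mod-3^ a k 3∤k
-- Chosen so that 1 - k (q + r - k q r) = (1 - k q) (1 - k r), a multiple of 3 times 3 ^ a.
... | q , divides x ex | r , divides y ey = q + r - + k * q * r ,
  divides (x * y) (trans (factor (+ k) q r) (trans (cong₂ _*_ ex ey) (regroup x y ((+ 3) ^ a))))
  where
  factor : ∀ k q r → 1ℤ - k * (q + r - k * q * r) ≡ (1ℤ - k * q) * (1ℤ - k * r)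
  factor = solve-∀
  regroup : ∀ x y p → x * + 3 * (y * p) ≡ x * y * (+ 3 * p)
  regroup = solve-∀

-- k divides 3 ^ b in the 3-adic integers, because ν₃(k) ≤ b.
quotient-mod-3^ : ∀ a b k → 0 ℕ.< k → k ℕ.< 3 ℕ.^ suc b →
  ∃[ q ] (+ 3) ^ a ∣ (+ 3) ^ b - + k * q
quotient-mod-3^ a b k 0<k k<3^1+b with 3 ℕ.∣? k
quotient-mod-3^ a b k 0<k k<3^1+b | no 3∤k with inverse-mod-3^ a k 3∤k
... | q , ∣1-kq = (+ 3) ^ b * q , subst (_ ∣_) (ring ((+ 3) ^ b) (+ k) q) (∣n⇒∣m*n ((+ 3) ^ b) ∣1-kq)
  where
  ring : ∀ p k q → p * (1ℤ - k * q) ≡ p - k * (p * q)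
  ring = solve-∀
quotient-mod-3^ a zero    k 0<k k<3 | yes 3∣k =
  contradiction (ℕ.∣⇒≤ {{ℕ.>-nonZero 0<k}} 3∣k) (ℕ.<⇒≱ k<3)
quotient-mod-3^ a (suc b) k 0<k k<3^2+b | yes (ℕ.divides (suc j) refl)
  -- Both k and the power of 3 lose one factor 3, which preserves the bound; the same q then serves
  -- for k.
  with quotient-mod-3^ a b (suc j) ℕ.z<s
         (ℕ.*-cancelʳ-< 3 (suc j) _ (subst (suc j ℕ.* 3 ℕ.<_) (ℕ.*-comm 3 (3 ℕ.^ suc b)) k<3^2+b))
... | q , ∣3^b-jq = q , subst (_ ∣_)
  (trans (ring ((+ 3) ^ b) (+ suc j) q) (cong (λ x → + 3 * (+ 3) ^ b - x * q) (sym (ℤ.pos-* (suc j) 3))))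
  (∣n⇒∣m*n (+ 3) ∣3^b-jq)
  where
  ring : ∀ p j q → + 3 * (p - j * q) ≡ + 3 * p - j * + 3 * q
  ring = solve-∀

-- Puts ν₃(k + 2) ≤ k in the form that `quotient-mod-3^` takes.
2+k<3^1+k : ∀ k → 2 ℕ.+ k ℕ.< 3 ℕ.^ suc k
2+k<3^1+k zero    = from-yes (2 ℕ.<? 3)
2+k<3^1+k (suc k) = ℕ.<-≤-trans (s≤s (2+k<3^1+k k))
  (ℕ.+-mono-≤ {1} (ℕ.m^n>0 3 (suc k)) (ℕ.m≤m+n (3 ℕ.^ suc k) _))

-- Writing d k as k c k up to a multiple of 3 ^ a S for k ≥ 2 makes the factor
-- m of newton-absorption appear, without dividing by the part of k prime to 3.
newton-linear-mod : ∀ d S → (∀ k → (+ 3) ^ k * S ∣ d (2 ℕ.+ k)) →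
  ∀ a m → (+ 3) ^ a ∣ + m → (+ 3) ^ a * S ∣ newton d m - d 0 - + m * d 1
newton-linear-mod d S ∣d a zero    _    = divides 0ℤ (cancel (d 0) (d 1))
  where
  cancel : ∀ x y → x - x - 0ℤ * y ≡ 0ℤ
  cancel = solve-∀
newton-linear-mod d S ∣d a (suc m) ∣1+m = subst (_ ∣_) combine
  -- The expansion of d splits into those of e and of k c k. The first is d 0 up to the error; by
  -- absorption the second is (m + 1) times a sum congruent to d 1 modulo S, and m + 1 contributes 3
  -- ^ a.
  (∣m∣n⇒∣m+n (newton-≡-head e e-∣ (suc m))
             (∣-trans (*-monoˡ-∣ S ∣1+m)
                      (*-monoʳ-∣ (+ suc m) (newton-≡-head (c ∘ suc) c-∣ m))))
  where
  quot : ∀ k → ∃[ q ] (+ 3) ^ a ∣ (+ 3) ^ k - + (2 ℕ.+ k) * q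
  quot k = quotient-mod-3^ a k (2 ℕ.+ k) ℕ.z<s (2+k<3^1+k k)

  c : ℕ → ℤ
  -- The values at 0 and 1 give e 0 = d 0 and e 1 = 0, so the constant and linear terms are exact.
  c 0             = 0ℤ
  c 1             = d 1
  c (suc (suc k)) = _∣_.quotient (∣d k) * proj₁ (quot k) * S

  e : ℕ → ℤ
  e k = d k - + k * c k

  c-∣ : ∀ k → S ∣ c (suc (suc k))
  c-∣ k = divides (_∣_.quotient (∣d k) * proj₁ (quot k)) refl

  e-∣ : ∀ k → (+ 3) ^ a * S ∣ e (suc k)
  e-∣ zero    = divides 0ℤ (cancel (d 1))
    where
    cancel : ∀ x → x - 1ℤ * x ≡ 0ℤ
    cancel = solve-∀
  e-∣ (suc k) with ∣d k | quot k
  ... | divides y ey | q , divides z ez = divides (y * z)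
    (trans (cong (λ x → x - + (2 ℕ.+ k) * (y * q * S)) ey)
      (trans (factor y ((+ 3) ^ k) S (+ (2 ℕ.+ k)) q)
        (trans (cong (y * S *_) ez) (regroup y S z ((+ 3) ^ a)))))
    where
    factor : ∀ y p s k q → y * (p * s) - k * (y * q * s) ≡ y * s * (p - k * q)
    factor = solve-∀
    regroup : ∀ y s z p → y * s * (z * p) ≡ y * z * (p * s)
    regroup = solve-∀

  combine : (newton e (suc m) - e 0) + + suc m * (newton (c ∘ suc) m - d 1) ≡
            newton d (suc m) - d 0 - + suc m * d 1
  combine = trans
    (ring (newton e (suc m)) (d 0) (+ suc m) (newton (c ∘ suc) m) (d 1))
    (cong (λ x → x - d 0 - + suc m * d 1)
      (trans (cong (λ x → newton e (suc m) + x) (sym (newton-absorption c m)))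
        (trans (sym (newton-+ e (λ k → + k * c k) (suc m)))
          (newton-cong (λ k → restore (d k) (+ k * c k)) (suc m)))))
    where
    ring : ∀ x d₀ m y d₁ → (x - (d₀ - 0ℤ * 0ℤ)) + m * (y - d₁) ≡ x + m * y - d₀ - m * d₁
    ring = solve-∀
    restore : ∀ x y → x - y + y ≡ x
    restore = solve-∀

-- Tribonacci numbers along an arithmetic progression.

data Triple : Set where
  triple : ℕ → ℕ → ℕ → Triple

eval : Triple → ℤ → ℤ → ℤ → ℤ
eval (triple a b c) x y z = + a * x + + b * y + + c * z

-- Strict, since the coefficients take exponentially long to evaluate lazily.
extend : Triple → Triple
extend (triple a b c) = force (a ℕ.+ c) λ a+c → force (b ℕ.+ c) λ b+c → triple c a+c b+c

-- T (z + j + n) is the combination of T (z + n), T (z + n + 1) and T (z + n + 2)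
-- with these coefficients.
coeffs : ℕ → Triple
coeffs zero    = triple 1 0 0
coeffs (suc j) = extend (coeffs j)

eval-extend : ∀ t x y z → eval (extend t) x y z ≡ eval t y z (z + y + x)
eval-extend (triple a b c) x y z =
  trans (cong (λ t → eval t x y z)
    (trans (force-≡ (a ℕ.+ c) _) (force-≡ (b ℕ.+ c) _)))
    (ring (+ a) (+ b) (+ c) x y z)
  where
  ring : ∀ a b c x y z →
    c * x + (a + c) * y + (b + c) * z ≡ a * y + b * z + c * (z + y + x)
  ring = solve-∀

-- The right-hand side of y³ = A y² + B y + 1 in coordinates; the + 1 adds `coeffs 0`.
combine : ℕ → Triple → ℕ → Triple → Triple
combine A (triple a b c) B (triple a′ b′ c′) =
  triple (A ℕ.* a ℕ.+ B ℕ.* a′ ℕ.+ 1) (A ℕ.* b ℕ.+ B ℕ.* b′) (A ℕ.* c ℕ.+ B ℕ.* c′)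

eval-combine : ∀ A s B t x y z →
  eval (combine A s B t) x y z ≡ + A * eval s x y z + + B * eval t x y z + x
eval-combine A (triple a b c) B (triple a′ b′ c′) x y z = begin
  (+ (A ℕ.* a ℕ.+ B ℕ.* a′) + 1ℤ) * x + + (A ℕ.* b ℕ.+ B ℕ.* b′) * y
    + + (A ℕ.* c ℕ.+ B ℕ.* c′) * z
    ≡⟨ cong₂ _+_ (cong₂ _+_ (cong (λ i → (i + 1ℤ) * x) (cast a a′)) (cong (_* y) (cast b b′)))
         (cong (_* z) (cast c c′)) ⟩
  (+ A * + a + + B * + a′ + 1ℤ) * x + (+ A * + b + + B * + b′) * y
    + (+ A * + c + + B * + c′) * z
    ≡⟨ ring (+ A) (+ B) (+ a) (+ b) (+ c) (+ a′) (+ b′) (+ c′) x y z ⟩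
  + A * (+ a * x + + b * y + + c * z) + + B * (+ a′ * x + + b′ * y + + c′ * z) + x ∎
  where
  open ≡-Reasoning
  cast : ∀ i j → + (A ℕ.* i ℕ.+ B ℕ.* j) ≡ + A * + i + + B * + j
  cast i j = cong₂ _+_ (ℤ.pos-* A i) (ℤ.pos-* B j)
  ring : ∀ A B a b c a′ b′ c′ x y z →
    (A * a + B * a′ + 1ℤ) * x + (A * b + B * b′) * y + (A * c + B * c′) * z ≡
    A * (a * x + b * y + c * z) + B * (a′ * x + b′ * y + c′ * z) + x
  ring = solve-∀

T-coeffs : ∀ z j n → T (z + + (j ℕ.+ n)) ≡
  eval (coeffs j) (T (z + + n)) (T (z + + (1 ℕ.+ n))) (T (z + + (2 ℕ.+ n)))
T-coeffs z zero    n = ring _ (T (z + + (1 ℕ.+ n))) (T (z + + (2 ℕ.+ n)))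
  where
  ring : ∀ x y z → x ≡ 1ℤ * x + 0ℤ * y + 0ℤ * z
  ring = solve-∀
T-coeffs z (suc j) n = begin
  T (z + + suc (j ℕ.+ n))
    ≡⟨ cong (λ k → T (z + + k)) (sym (ℕ.+-suc j n)) ⟩
  T (z + + (j ℕ.+ suc n))
    ≡⟨ T-coeffs z j (suc n) ⟩
  eval (coeffs j) (u 1) (u 2) (T (z + + (3 ℕ.+ n)))
    ≡⟨ cong (eval (coeffs j) (u 1) (u 2)) rec ⟩
  eval (coeffs j) (u 1) (u 2) (u 2 + u 1 + u 0)
    ≡⟨ eval-extend (coeffs j) (u 0) (u 1) (u 2) ⟨
  eval (coeffs (suc j)) (u 0) (u 1) (u 2) ∎
  where
  open ≡-Reasoning
  u : ℕ → ℤ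
  u i = T (z + + (i ℕ.+ n))
  shift : ∀ i → z + + n + + i ≡ z + + (i ℕ.+ n)
  shift i = trans (ℤ.+-assoc z (+ n) (+ i)) (cong (λ k → z + + k) (ℕ.+-comm n i))
  rec : u 3 ≡ u 2 + u 1 + u 0
  rec = trans (cong T (sym (shift 3))) (trans (T-rec (z + + n))
    (cong (_+ u 0) (cong₂ _+_ (cong T (shift 2)) (cong T (shift 1)))))

-- T (z + j), in a form that is feasible to evaluate.
value : ℤ → ℕ → ℤ
value z j = eval (coeffs j) (T (z + + 0)) (T (z + + 1)) (T (z + + 2))

T≡value : ∀ z j → T (z + + j) ≡ value z j
T≡value z j = trans (cong (λ k → T (z + + k)) (sym (ℕ.+-identityʳ j))) (T-coeffs z j 0)

-- y³ = A y² + B y + 1 is the equation of y = x^p, where x³ = x² + x + 1; the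
-- divisibilities are those of its coefficients in powers of y - 1.
record Stride (p : ℕ) : Set where
  field
    A B : ℕ
    -- `coeffs j` holds the coordinates of x^j in the basis 1, x, x², so this is the equation of y
    -- itself.
    combination : coeffs (p ℕ.+ (p ℕ.+ p)) ≡ combine A (coeffs (p ℕ.+ p)) B (coeffs p)
    ∣α : + 3 ∣ + A - + 3
    ∣β : + 9 ∣ + 2 * + A + + B - + 3
    ∣γ : + 27 ∣ + A + + B

  T-recurrence : ∀ z → Recurrence (+ A) (+ B) (λ m → T (z + + (m ℕ.* p)))
  T-recurrence z m = begin
    T (z + + (p ℕ.+ (p ℕ.+ (p ℕ.+ m ℕ.* p))))
      ≡⟨ cong (λ k → T (z + + k)) (trans (cong (p ℕ.+_) (sym (ℕ.+-assoc p p _))) (sym (ℕ.+-assoc p (p ℕ.+ p) _))) ⟩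
    T (z + + (p ℕ.+ (p ℕ.+ p) ℕ.+ m ℕ.* p))
      ≡⟨ T-coeffs z (p ℕ.+ (p ℕ.+ p)) (m ℕ.* p) ⟩
    eval (coeffs (p ℕ.+ (p ℕ.+ p))) x y w
      ≡⟨ cong (λ t → eval t x y w) combination ⟩
    eval (combine A (coeffs (p ℕ.+ p)) B (coeffs p)) x y w
      ≡⟨ eval-combine A (coeffs (p ℕ.+ p)) B (coeffs p) x y w ⟩
    + A * eval (coeffs (p ℕ.+ p)) x y w + + B * eval (coeffs p) x y w + x
      ≡⟨ cong₂ (λ s t → + A * s + + B * t + x) (T-coeffs z (p ℕ.+ p) (m ℕ.* p)) (T-coeffs z p (m ℕ.* p)) ⟨
    + A * T (z + + (p ℕ.+ p ℕ.+ m ℕ.* p)) + + B * T (z + + (p ℕ.+ m ℕ.* p)) + x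
      ≡⟨ cong (λ k → + A * T (z + + k) + + B * T (z + + (p ℕ.+ m ℕ.* p)) + x) (ℕ.+-assoc p p _) ⟩
    + A * T (z + + (p ℕ.+ (p ℕ.+ m ℕ.* p))) + + B * T (z + + (p ℕ.+ m ℕ.* p)) + x ∎
    where
    open ≡-Reasoning
    x y w : ℤ
    x = T (z + + (m ℕ.* p))
    y = T (z + + (1 ℕ.+ m ℕ.* p))
    w = T (z + + (2 ℕ.+ m ℕ.* p))

-- A is the sum of x^13 over the three roots x, and B is minus the sum of x^(-13), since the roots
-- have product 1.
stride-13 : Stride 13
stride-13 = record
  { A = 2757 ; B = 105 ; combination = refl
  ; ∣α = divides (+ 918) refl
  ; ∣β = divides (+ 624) refl
  ; ∣γ = divides (+ 106) refl }

-- The zeros -4 and -17 share the class of 9 modulo 13; modulo 39 they are separated.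
stride-39 : Stride 39
stride-39 = record
  { A = 20956960551 ; B = 289167 ; combination = refl
  ; ∣α = divides (+ 6985653516) refl
  ; ∣β = divides (+ 4657134474) refl
  ; ∣γ = divides (+ 776194434) refl }

-- The base cases of `∣-differences`, stated through `value` so that `start?` can decide them by
-- evaluation.
Start : (p : ℕ) (z : ℤ) (t : ℕ) → Set
Start p z t = (+ 3) ^ t ∣ d 0 × (+ 3) ^ (1 ℕ.+ t) ∣ d 1 × (+ 3) ^ (2 ℕ.+ t) ∣ d 2
  where
  d : ℕ → ℤ
  d = differences λ m → value z (m ℕ.* p)

start? : ∀ p z t → Dec (Start p z t)
start? p z t = (_ ∣? _) ×-dec (_ ∣? _) ×-dec (_ ∣? _)

Recurrence-resp-≗ : ∀ {A B f g} → (∀ m → f m ≡ g m) → Recurrence A B f → Recurrence A B g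
Recurrence-resp-≗ {A} {B} f≗g rec m = trans (sym (f≗g (3 ℕ.+ m))) (trans (rec m)
  (cong₂ _+_ (cong₂ (λ x y → A * x + B * y) (f≗g (2 ℕ.+ m)) (f≗g (1 ℕ.+ m))) (f≗g m)))

T-expansion : ∀ {p} → Stride p → ∀ z t → Start p z t → ∀ a m → (+ 3) ^ a ∣ + m →
  (+ 3) ^ a * (+ 3) ^ (2 ℕ.+ t) ∣
    T (z + + (m ℕ.* p)) - value z 0 - + m * (value z (1 ℕ.* p) - value z 0)
T-expansion {p} stride z t (∣d₀ , ∣d₁ , ∣d₂) a m ∣m =
  subst (λ x → _ ∣ x - value z 0 - + m * (value z (1 ℕ.* p) - value z 0))
    (trans (newton-differences f m) (sym (T≡value z (m ℕ.* p))))
    (newton-linear-mod (differences f) ((+ 3) ^ (2 ℕ.+ t)) ∣d a m ∣m)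
  where
  open Stride stride
  f : ℕ → ℤ
  f m = value z (m ℕ.* p)
  rec : Recurrence (+ A) (+ B) f
  rec = Recurrence-resp-≗ {+ A} {+ B} (λ m → T≡value z (m ℕ.* p)) (T-recurrence z)
  ∣d : ∀ k → (+ 3) ^ k * (+ 3) ^ (2 ℕ.+ t) ∣ differences f (2 ℕ.+ k)
  ∣d k = subst (_∣ differences f (2 ℕ.+ k))
    (trans (cong ((+ 3) ^_) (trans (cong (2 ℕ.+_) (ℕ.+-comm k t)) (ℕ.+-comm (2 ℕ.+ t) k)))
      (ℤ.^-distribˡ-+-* (+ 3) k (2 ℕ.+ t)))
    (∣-differences {+ A} {+ B} f t rec ∣α ∣β ∣γ ∣d₀ ∣d₁ ∣d₂ (2 ℕ.+ k))

-- Computing 3-adic valuations.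

3∤* : ∀ {x y} → ¬ + 3 ∣ x → ¬ + 3 ∣ y → ¬ + 3 ∣ x * y
3∤* {x} {y} 3∤x 3∤y 3∣xy =
  [ 3∤x ∘ ∣ᵤ⇒∣ , 3∤y ∘ ∣ᵤ⇒∣ ]′
    (euclidsLemma ℤ.∣ x ∣ ℤ.∣ y ∣ (from-yes (prime? 3))
      (subst (3 ℕ.∣_) (ℤ.abs-* x y) (∣⇒∣ᵤ 3∣xy)))

pos-^ : ∀ p k → + (p ℕ.^ k) ≡ (+ p) ^ k
pos-^ p zero    = refl
pos-^ p (suc k) = trans (ℤ.pos-* p (p ℕ.^ k)) (cong (+ p *_) (pos-^ p k))

ν-unique : ∀ y k → (+ 3) ^ k ∣ y → ¬ (+ 3) ^ suc k ∣ y → ν 3 y ≡ [ k ]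
ν-unique y k ∣y ∤y = Equivalence.from (ν-spec 3 y {{ℤ.≢-nonZero y≢0}} k)
  ( ∣⇒∣ᵤ (subst (_∣ y) (sym (pos-^ 3 k)) ∣y)
  , λ d → ∤y (subst (_∣ y) (pos-^ 3 (suc k)) (∣ᵤ⇒∣ d)))
  where
  y≢0 : ¬ y ≡ 0ℤ
  y≢0 refl = ∤y (divides 0ℤ refl)

ν-^-* : ∀ k x → ¬ + 3 ∣ x → ν 3 (x * (+ 3) ^ k) ≡ [ k ]
ν-^-* k x 3∤x = ν-unique _ k (divides x refl)
  λ d → 3∤x (*-cancelʳ-∣ ((+ 3) ^ k) {{ℤ.≢-nonZero λ e → contradiction (ℤ.i^n≡0⇒i≡0 (+ 3) k e) λ ()}} d)

split-3-power : ∀ m → ∃[ k ] ∃[ x ] + suc m ≡ x * (+ 3) ^ k × ¬ + 3 ∣ x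
split-3-power m with Equivalence.to (maxExp-exact 3 (suc m) (maxExp 3 (suc m) (suc m))) refl
... | ℕ.divides x eq , ∤ = k , + x , eqℤ , λ 3∣x → ∤ (∣⇒∣ᵤ
  (subst (_∣ + suc m) (sym (pos-^ 3 (suc k))) (subst (_ ∣_) (sym eqℤ) (*-monoˡ-∣ ((+ 3) ^ k) 3∣x))))
  where
  k = maxExp 3 (suc m) (suc m)
  eqℤ : + suc m ≡ + x * (+ 3) ^ k
  eqℤ = trans (cong +_ eq) (trans (ℤ.pos-* x (3 ℕ.^ k)) (cong (+ x *_) (pos-^ 3 k)))

-- For a = ν₃(m + 1), the term (m + 1) v has valuation exactly a + c while the error is divisible by
-- 3 ^ (a + c + 1), so the term decides the valuation of y.
ν-linear-mod : ∀ m c v y → (+ 3) ^ c ∣ v → ¬ (+ 3) ^ suc c ∣ v →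
  (∀ a → (+ 3) ^ a ∣ + suc m → (+ 3) ^ a * (+ 3) ^ suc c ∣ y - + suc m * v) →
  ν 3 y ≡ ν 3 (+ suc m) ∔ c
ν-linear-mod m c v y (divides u refl) ∤v approx with split-3-power m
... | k , x , eq , 3∤x with approx k (divides x eq)
... | divides w ew = trans (cong (ν 3) y-eq) (trans (ν-^-* (k ℕ.+ c) (x * u + + 3 * w) 3∤sum)
    (sym (cong (_∔ c) (trans (cong (ν 3) eq) (ν-^-* k x 3∤x)))))
  where
  3∤u : ¬ + 3 ∣ u
  3∤u 3∣u = ∤v (*-monoˡ-∣ ((+ 3) ^ c) 3∣u)
  3∤sum : ¬ + 3 ∣ x * u + + 3 * w
  3∤sum d = 3∤* 3∤x 3∤u (∣m+n∣n⇒∣m d (∣m⇒∣m*n w (divides 1ℤ refl)))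
  restore : ∀ y z → y ≡ y - z + z
  restore = solve-∀
  ring : ∀ w p q x u → w * (p * (+ 3 * q)) + x * p * (u * q) ≡ (x * u + + 3 * w) * (p * q)
  ring = solve-∀
  y-eq : y ≡ (x * u + + 3 * w) * (+ 3) ^ (k ℕ.+ c)
  y-eq = trans (restore y (+ suc m * v)) (trans (cong₂ _+_ ew (cong (_* v) eq))
    (trans (ring w ((+ 3) ^ k) ((+ 3) ^ c) x u)
      (cong ((x * u + + 3 * w) *_) (sym (ℤ.^-distribˡ-+-* (+ 3) k c)))))

-- With a = 0, both the error and m d₁ vanish modulo 3 ^ (t + 1), leaving d₀, whose valuation is t.
ν-T-constant : ∀ {p} → Stride p → ∀ z t → {True (start? p z t)} → {False ((+ 3) ^ suc t ∣? value z 0)} →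
  ∀ m → ν 3 (T (z + + (m ℕ.* p))) ≡ [ t ]
ν-T-constant {p} stride z t {start} {exact} m = ν-unique _ t
  (subst (_ ∣_) (restore x v) (∣m∣n⇒∣m+n (∣-trans (divides (+ 3) refl) ∣x-v) (proj₁ ∣d)))
  (λ d → toWitnessFalse exact (subst (_ ∣_) (cancel x v) (∣m∣n⇒∣m-n d ∣x-v)))
  where
  ∣d : Start p z t
  ∣d = toWitness start
  x v Δv : ℤ
  x = T (z + + (m ℕ.* p))
  v = value z 0
  Δv = value z (1 ℕ.* p) - v
  restore : ∀ x y → x - y + y ≡ x
  restore = solve-∀
  cancel : ∀ x y → x - (x - y) ≡ y
  cancel = solve-∀
  ∣x-v : (+ 3) ^ suc t ∣ x - v
  ∣x-v = subst (_ ∣_) (restore (x - v) (+ m * Δv))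
    (∣m∣n⇒∣m+n
      (∣-trans (divides (1ℤ * + 3) (sym (ℤ.*-assoc 1ℤ (+ 3) _)))
        (T-expansion stride z t ∣d 0 m (divides (+ m) (sym (ℤ.*-identityʳ _)))))
      (∣n⇒∣m*n (+ m) (proj₁ (proj₂ ∣d))))

ν-T-zero : ∀ {p} → Stride p → ∀ z t → {True (start? p z t)} →
  {True (value z 0 ℤ.≟ 0ℤ)} → {False ((+ 3) ^ (2 ℕ.+ t) ∣? value z (1 ℕ.* p))} →
  ∀ m → ν 3 (T (z + + (suc m ℕ.* p))) ≡ ν 3 (+ suc m) ∔ suc t
ν-T-zero {p} stride z t {start} {root} {exact} m =
  ν-linear-mod m (suc t) (value z (1 ℕ.* p)) (T (z + + (suc m ℕ.* p)))
    (subst (_ ∣_) v-0 (proj₁ (proj₂ (toWitness start))))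
    (toWitnessFalse exact)
    (λ a ∣m → subst (_ ∣_)
      (cong₂ (λ r s → r - + suc m * s) x-0 v-0)
      (T-expansion stride z t (toWitness start) a (suc m) ∣m))
  where
  v-0 : value z (1 ℕ.* p) - value z 0 ≡ value z (1 ℕ.* p)
  v-0 = trans (cong (λ r → value z (1 ℕ.* p) - r) (toWitness root)) (ℤ.+-identityʳ _)
  x-0 : T (z + + (suc m ℕ.* p)) - value z 0 ≡ T (z + + (suc m ℕ.* p))
  x-0 = trans (cong (λ r → T (z + + (suc m ℕ.* p)) - r) (toWitness root)) (ℤ.+-identityʳ _)

-- `ν-linear-mod` with zero error. It trades the valuation of the index m + 1 for that of the
-- distance (m + 1) p from a zero of T.
ν-*-constant : ∀ p c → {True ((+ 3) ^ c ∣? + p)} → {False ((+ 3) ^ suc c ∣? + p)} →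
  ∀ m → ν 3 (+ (suc m ℕ.* p)) ≡ ν 3 (+ suc m) ∔ c
ν-*-constant p c {∣p} {∤p} m =
  ν-linear-mod m c (+ p) (+ (suc m ℕ.* p)) (toWitness ∣p) (toWitnessFalse ∤p)
    (λ a _ → divides 0ℤ (ℤ.i≡j⇒i-j≡0 (ℤ.pos-* (suc m) p)))

∔-assoc : ∀ x k l → x ∔ k ∔ l ≡ x ∔ (k ℕ.+ l)
∔-assoc [ j ] k l = cong [_] (ℕ.+-assoc j k l)
∔-assoc ⊤⁺    k l = refl

-- Residue classes and the theorem.

-- p divides n + c because n ≡ r ≡ - c, and n + c is positive, so its quotient by p is at least 1.
residue-class : ∀ {n} p c r .{{_ : ℕ.NonZero p}} → 1ℤ ≤ n → n ≡ + r [mod p ] → + p ∣ + r + + c →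
  ∃[ m ] n ≡ - (+ c) + + (suc m ℕ.* p)
residue-class {+[1+ j ]} (suc p) c r (+≤+ _) p∣n-r p∣r+c
  with subst (_ ∣_) (regroup +[1+ j ] (+ r) (+ c)) (∣m∣n⇒∣m+n (∣ᵤ⇒∣ {i = +[1+ j ] - + r} p∣n-r) p∣r+c)
  where
  regroup : ∀ n r c → n - r + (r + c) ≡ n + c
  regroup = solve-∀
... | divides +[1+ m ] n+c≡ = m , trans (restore +[1+ j ] (+ c)) (cong (λ x → - (+ c) + x) n+c≡)
  where
  restore : ∀ n c → n ≡ - c + (n + c)
  restore = solve-∀
... | divides (+ 0)    ()
... | divides -[1+ m ] ()

ν-T-constant-class : ∀ {p} .{{_ : ℕ.NonZero p}} → Stride p → ∀ r t →
  {True (r ℕ.≤? p)} → {True (start? p (+ r) t)} → {False ((+ 3) ^ suc t ∣? value (+ r) 0)} →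
  ∀ n → 1ℤ ≤ n → n ≡ + r [mod p ] → ν 3 (T n) ≡ [ t ]
ν-T-constant-class {p} stride r t {r≤p} {start} {exact} n 1≤n n≡r
  -- With c = p - r, the number - c + (m + 1) p is r + m p, so the progression starts at r.
  with residue-class p (p ℕ.∸ r) r 1≤n n≡r
         (divides 1ℤ (trans (cong +_ (ℕ.m+[n∸m]≡n (toWitness r≤p))) (sym (ℤ.*-identityˡ (+ p)))))
... | m , refl = trans (cong (ν 3 ∘ T) shift) (ν-T-constant stride (+ r) t {start} {exact} m)
  where
  c : ℕ
  c = p ℕ.∸ r
  cancel : ∀ r c x → - c + (r + c + x) ≡ r + x
  cancel = solve-∀
  shift : - (+ c) + + (p ℕ.+ m ℕ.* p) ≡ + r + + (m ℕ.* p)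
  shift = trans (cong (λ i → - (+ c) + (+ i + + (m ℕ.* p))) (sym (ℕ.m+[n∸m]≡n (toWitness r≤p))))
    (cancel (+ r) (+ c) (+ (m ℕ.* p)))

-- Here T (- c) = 0, and n + c = p m has valuation ν₃(m) + e.
ν-T-zero-class : ∀ {p} .{{_ : ℕ.NonZero p}} → Stride p → ∀ c r e f t → e ℕ.+ f ≡ suc t →
  {True (+ p ∣? + r + + c)} → {True (start? p (- (+ c)) t)} →
  {True (value (- (+ c)) 0 ℤ.≟ 0ℤ)} →
  {False ((+ 3) ^ (2 ℕ.+ t) ∣? value (- (+ c)) (1 ℕ.* p))} →
  {True ((+ 3) ^ e ∣? + p)} → {False ((+ 3) ^ suc e ∣? + p)} →
  ∀ n → 1ℤ ≤ n → n ≡ + r [mod p ] → ν 3 (T n) ≡ ν 3 (n + + c) ∔ f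
ν-T-zero-class {p} stride c r e f t e+f≡1+t {p∣r+c} {start} {root} {exact} {∣p} {∤p} n 1≤n n≡r
  with residue-class p c r 1≤n n≡r (toWitness p∣r+c)
... | m , refl = begin
  ν 3 (T (- (+ c) + + (suc m ℕ.* p)))
    ≡⟨ ν-T-zero stride (- (+ c)) t {start} {root} {exact} m ⟩
  ν 3 (+ suc m) ∔ suc t
    -- Of the t + 1 factors 3, e = ν₃(p) pass into n + c and f remain.
    ≡⟨ cong (ν 3 (+ suc m) ∔_) e+f≡1+t ⟨
  ν 3 (+ suc m) ∔ (e ℕ.+ f)
    ≡⟨ ∔-assoc (ν 3 (+ suc m)) e f ⟨
  ν 3 (+ suc m) ∔ e ∔ f
    ≡⟨ cong (_∔ f) (ν-*-constant p e {∣p} {∤p} m) ⟨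
  ν 3 (+ (suc m ℕ.* p)) ∔ f
    ≡⟨ cong (λ i → ν 3 i ∔ f) (cancel (+ c) (+ (suc m ℕ.* p))) ⟨
  ν 3 (- (+ c) + + (suc m ℕ.* p) + + c) ∔ f ∎
  where
  open ≡-Reasoning
  cancel : ∀ c x → - c + x + c ≡ x
  cancel = solve-∀

theorem3 : ∀ (n : ℤ) → 1ℤ ≤ n →
    (Any (λ r → n ≡ r [mod 13 ]) (+ 1 ∷ + 2 ∷ + 3 ∷ + 4 ∷ + 5 ∷ + 6 ∷ + 8 ∷ + 10 ∷ + 11 ∷ []) →
    ν 3 (T n) ≡ [ 0 ]) ×
    (n ≡ + 7 [mod 13 ] → ν 3 (T n) ≡ [ 1 ]) ×
    (n ≡ + 0 [mod 13 ] → ν 3 (T n) ≡ ν 3 n ∔ 2) ×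
    (n ≡ + 12 [mod 13 ] → ν 3 (T n) ≡ ν 3 (n + + 1) ∔ 2) ×
    (n ≡ + 9 [mod 39 ] → ν 3 (T n) ≡ [ 4 ]) ×
    (n ≡ + 22 [mod 39 ] → ν 3 (T n) ≡ ν 3 (n + + 17) ∔ 4) ×
    (n ≡ + 35 [mod 39 ] → ν 3 (T n) ≡ ν 3 (n + + 4) ∔ 4)
theorem3 n 1≤n =
    (λ n≡r → let ν≡0 , n≡ = All.lookupAny units n≡r in ν≡0 n≡)
  , ν-T-constant-class stride-13 7 1 n 1≤n
  -- The five numerals are c, r, e, f and t: the zero is - c, its class is r, and e is 0 for 13 and
  -- 1 for 39.
  , (λ n≡0 → subst (λ i → ν 3 (T n) ≡ ν 3 i ∔ 2) (ℤ.+-identityʳ n)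
      (ν-T-zero-class stride-13 0 0 0 2 1 refl n 1≤n n≡0))
  , ν-T-zero-class stride-13 1 12 0 2 1 refl n 1≤n
  , ν-T-constant-class stride-39 9 4 n 1≤n
  , ν-T-zero-class stride-39 17 22 1 4 4 refl n 1≤n
  , ν-T-zero-class stride-39 4 35 1 4 4 refl n 1≤n
  where
  units : All (λ r → n ≡ r [mod 13 ] → ν 3 (T n) ≡ [ 0 ])
    (+ 1 ∷ + 2 ∷ + 3 ∷ + 4 ∷ + 5 ∷ + 6 ∷ + 8 ∷ + 10 ∷ + 11 ∷ [])
  units =
    unit 1 ∷ unit 2 ∷ unit 3 ∷ unit 4 ∷ unit 5 ∷ unit 6 ∷ unit 8 ∷ unit 10 ∷ unit 11 ∷ []
    where
    unit : ∀ r → {True (r ℕ.≤? 13)} → {True (start? 13 (+ r) 0)} →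
      {False ((+ 3) ^ 1 ∣? value (+ r) 0)} → n ≡ + r [mod 13 ] → ν 3 (T n) ≡ [ 0 ]
    unit r {r≤13} {start} {exact} =
      ν-T-constant-class stride-13 r 0 {r≤13} {start} {exact} n 1≤n
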